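{- Let $T_n$ be the chain triangular cactus of length $n$. For every $n\geq 3$, $$D(T_n,x)=(x^2+2x)\,D(T_{n-1},x)+(x^2+x)\,D(T_{n-2},x),$$ with initial conditions $D(T_1,x)=x^3+3x^2+3x$ and $D(T_2,x)=x^5+5x^4+10x^3+8x^2+x$.
   Context: For a finite simple graph $G=(V,E)$, a set $S\subseteq V$ is dominating if every vertex of $V\setminus S$ is adjacent to at least one vertex of $S$. Let $d(G,i)$ be the number of dominating sets of $G$ of cardinality $i$. The domination polynomial of $G$ is $D(G,x)=\sum_{i=\gamma(G)}^{|V|} d(G,i)x^i$, where $\gamma(G)$ is the minimum cardinality of a dominating set. A triangular cactus is a connected graph in which no edge lies in more than one cycle and all of whose blocks are triangles. It is a chain triangular cactus if each triangle has at most two cut-vertices and each cut-vertex is shared by exactly two triangles; its length is the number of triangles. All chain triangular cacti of the same length $n\ge 1$ are isomorphic, and $T_n$ denotes this graph. Concretely, $T_n$ has vertices $c_0,\dots,c_n,m_1,\dots,m_n$ and edges $c_{i-1}c_i,\ c_{i-1}m_i,\ c_im_i$ for $1\le i\le n$. -}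

module Defs where

open import Data.Fin using (Fin; zero; suc; inject₁)
open import Data.Fin.Properties using (all?; any?; suc-injective)
  renaming (_≟_ to _≟ᶠ_)
open import Data.Fin.Subset using (Subset; inside; outside; _∈_; _∉_; ∣_∣)
open import Data.Fin.Subset.Properties using (_∈?_)
open import Data.List using (List; []; _∷_; _++_; map; foldr; filter; length; replicate; applyUpTo)
open import Data.List.Extrema.Nat using (min)
open import Data.Nat using (ℕ; zero; suc; _+_; _*_; _∸_; _≟_)
open import Data.Product using (∃; _×_; _,_)
open import Data.Sum using (_⊎_; inj₁; inj₂; [_,_]′)
open import Data.Vec using ([]; _∷_)
open import Relation.Binary.Construct.Closure.Symmetric using (SymClosure; fwd; bwd; symmetric)
open import Relation.Binary.Core using (Rel)
open import Relation.Binary.Definitions using (Decidable; Irreflexive; Symmetric)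
open import Relation.Binary.PropositionalEquality using (_≡_; _≢_; refl; cong; sym)
open import Relation.Nullary using (Dec; ¬?; _×-dec_; _⊎-dec_; _→-dec_)
open import Relation.Nullary.Decidable using (map′)
open import Level using (0ℓ)

-- Coefficient lists, lowest degree first; trailing zeros are permitted, so
-- polynomials are compared with _≈_ rather than _≡_.  ℕ suffices for the
-- coefficients: ℕ[x] embeds in ℤ[x], and no negative coefficient occurs.

Poly : Set
Poly = List ℕ

coeff : Poly → ℕ → ℕ
coeff []      _       = 0
coeff (a ∷ _) zero    = a
coeff (_ ∷ p) (suc k) = coeff p k

infix  4 _≈_
infixl 6 _⊕_
infixl 7 _⊗_
infixr 8 _·_
infix  9 x^_

_≈_ : Rel Poly 0ℓ
p ≈ q = ∀ k → coeff p k ≡ coeff q k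

_⊕_ : Poly → Poly → Poly
[]      ⊕ q       = q
(a ∷ p) ⊕ []      = a ∷ p
(a ∷ p) ⊕ (b ∷ q) = (a + b) ∷ (p ⊕ q)

_·_ : ℕ → Poly → Poly
a · p = map (a *_) p

_⊗_ : Poly → Poly → Poly
[]      ⊗ q = []
(a ∷ p) ⊗ q = a · q ⊕ (0 ∷ (p ⊗ q))

x^_ : ℕ → Poly
x^ k = replicate k 0 ++ (1 ∷ [])

-- ∑[ a to b ] f is the sum of f i over a ≤ i ≤ b.
∑[_to_] : ℕ → ℕ → (ℕ → Poly) → Poly
∑[ a to b ] f = foldr _⊕_ [] (applyUpTo (λ j → f (a + j)) (suc b ∸ a))

record Graph : Set₁ where
  field
    order    : ℕ
    _~_      : Rel (Fin order) 0ℓ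
    _~?_     : Decidable _~_
    ~-sym    : Symmetric _~_
    ~-irrefl : Irreflexive _≡_ _~_

subsets : ∀ n → List (Subset n)
subsets zero    = [] ∷ []
subsets (suc n) = map (outside ∷_) (subsets n) ++ map (inside ∷_) (subsets n)

module _ (G : Graph) where
  open Graph G

  Dominating : Subset order → Set
  Dominating S = ∀ v → v ∉ S → ∃ λ u → u ∈ S × v ~ u

  dominating? : ∀ S → Dec (Dominating S)
  dominating? S = all? λ v →
    ¬? (v ∈? S) →-dec any? λ u → (u ∈? S) ×-dec (v ~? u)

  dominatingSets : List (Subset order)
  dominatingSets = filter dominating? (subsets order)

  d : ℕ → ℕ
  d i = length (filter (λ S → ∣ S ∣ ≟ i) dominatingSets)

  -- The default value order is the size of the full vertex set, which is
  -- itself dominating, so it does not affect the minimum.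
  γ : ℕ
  γ = min order (map ∣_∣ dominatingSets)

  D : Poly
  D = ∑[ γ to order ] λ i → d i · x^ i

-- The 2n + 1 vertices of the chain cactus, in the order c₀, m₁, c₁, …, mₙ, cₙ.
-- Here c n i is cᵢ, whereas m n i is mᵢ₊₁ since Fin counts from zero.

c : ∀ n → Fin (suc n) → Fin (suc (n * 2))
c _       zero    = zero
c (suc n) (suc i) = suc (suc (c n i))

m : ∀ n → Fin n → Fin (suc (n * 2))
m (suc n) zero    = suc zero
m (suc n) (suc i) = suc (suc (m n i))

data Edge (n : ℕ) : Rel (Fin (suc (n * 2))) 0ℓ where
  cc : (i : Fin n) → Edge n (c n (inject₁ i)) (c n (suc i))
  cm : (i : Fin n) → Edge n (c n (inject₁ i)) (m n i)
  mc : (i : Fin n) → Edge n (m n i) (c n (suc i))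

c-injective : ∀ n {i j} → c n i ≡ c n j → i ≡ j
c-injective zero    {zero}  {zero}  _ = refl
c-injective (suc n) {zero}  {zero}  _ = refl
c-injective (suc n) {suc i} {suc j} p =
  cong suc (c-injective n (suc-injective (suc-injective p)))

m-injective : ∀ n {i j} → m n i ≡ m n j → i ≡ j
m-injective (suc n) {zero}  {zero}  _ = refl
m-injective (suc n) {suc i} {suc j} p =
  cong suc (m-injective n (suc-injective (suc-injective p)))

c≢m : ∀ n i j → c n i ≢ m n j
c≢m (suc n) zero    zero    ()
c≢m (suc n) zero    (suc j) ()
c≢m (suc n) (suc i) zero    ()
c≢m (suc n) (suc i) (suc j) p = c≢m n i j (suc-injective (suc-injective p))

c-or-m : ∀ n v → (∃ λ i → v ≡ c n i) ⊎ (∃ λ i → v ≡ m n i)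
c-or-m _       zero          = inj₁ (zero , refl)
c-or-m (suc n) (suc zero)    = inj₂ (zero , refl)
c-or-m (suc n) (suc (suc v)) with c-or-m n v
... | inj₁ (i , p) = inj₁ (suc i , cong (λ w → suc (suc w)) p)
... | inj₂ (i , p) = inj₂ (suc i , cong (λ w → suc (suc w)) p)

inject₁≢suc : ∀ {n} (i : Fin n) → inject₁ i ≢ suc i
inject₁≢suc (suc i) p = inject₁≢suc i (suc-injective p)

edge-≢ : ∀ {n u v} → Edge n u v → u ≢ v
edge-≢ {n} (cc i) p = inject₁≢suc i (c-injective n p)
edge-≢ {n} (cm i) p = c≢m n (inject₁ i) i p
edge-≢ {n} (mc i) p = c≢m n (suc i) i (sym p)

edge? : ∀ n → Decidable (Edge n)
edge? n u v = map′ to from (any? λ i →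
         (u ≟ᶠ c n (inject₁ i)) ×-dec (v ≟ᶠ c n (suc i))
  ⊎-dec ((u ≟ᶠ c n (inject₁ i)) ×-dec (v ≟ᶠ m n i)
  ⊎-dec  (u ≟ᶠ m n i)           ×-dec (v ≟ᶠ c n (suc i))))
  where
  Ends : Fin n → Set
  Ends i = (u ≡ c n (inject₁ i) × v ≡ c n (suc i))
         ⊎ (u ≡ c n (inject₁ i) × v ≡ m n i)
         ⊎ (u ≡ m n i           × v ≡ c n (suc i))

  to : ∃ Ends → Edge n u v
  to (i , inj₁ (refl , refl))        = cc i
  to (i , inj₂ (inj₁ (refl , refl))) = cm i
  to (i , inj₂ (inj₂ (refl , refl))) = mc i

  from : Edge n u v → ∃ Ends
  from (cc i) = i , inj₁ (refl , refl)
  from (cm i) = i , inj₂ (inj₁ (refl , refl))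
  from (mc i) = i , inj₂ (inj₂ (refl , refl))

-- T 0, a single vertex, is an artefact of indexing by ℕ.
T : ℕ → Graph
T n = record
  { order    = suc (n * 2)
  ; _~_      = SymClosure (Edge n)
  ; _~?_     = λ u v → map′ [ fwd , bwd ]′ (λ { (fwd e) → inj₁ e ; (bwd e) → inj₂ e })
                            (edge? n u v ⊎-dec edge? n v u)
  ; ~-sym    = symmetric (Edge n)
  ; ~-irrefl = λ { p (fwd e) → edge-≢ e p ; p (bwd e) → edge-≢ e (sym p) }
  }

{-# OPTIONS --safe #-}

-- The closed neighbourhood of mᵢ is the i-th triangle, and every closed neighbourhood contains
-- a triangle when n ≥ 1, so the dominating sets of Tₙ are the sets meeting every triangle.
-- Let N n be the counting polynomial of these transversals, and xA and B the parts of N counting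
-- the transversals that contain c₀ and those that do not.  Deciding the membership of m₁ and then
-- of c₁ gives A (n + 1) = (1 + x) N n and B (n + 1) = x N n + x A n, whence
-- N (n + 2) = (x² + 2x) N (n + 1) + x A (n + 1) = (x² + 2x) N (n + 1) + (x² + x) N n.

module Submission where

open import Defs
open import Data.Empty using (⊥-elim)
open import Data.Fin using (Fin; zero; suc; inject₁)
open import Data.Fin.Properties using (all?)
open import Data.Fin.Subset using (Subset; inside; outside; _∈_; ∣_∣)
open import Data.Fin.Subset.Properties using (_∈?_; drop-there; ∣p∣≤n)
open import Data.List using (List; []; _∷_; _++_; map; foldr; filter; length; applyUpTo)
open import Data.List.Extrema.Nat using (min≤xs)
open import Data.List.Properties using (length-++; length-map; filter-++; filter-≐; filter-none)
open import Data.List.Relation.Unary.All as All using (All)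
open import Data.List.Relation.Unary.All.Properties using (map⁻)
open import Data.Nat using (ℕ; zero; suc; _+_; _*_; _∸_; _≤_; _<_; _≥_; _≟_; _≤?_; z≤n; s≤s)
open import Data.Nat.Properties
open import Data.Nat.Tactic.RingSolver using (solve-∀)
open import Data.Product using (_×_; _,_; proj₁; proj₂)
open import Data.Sum as Sum using (_⊎_; inj₁; inj₂)
open import Data.Vec using ([]; _∷_; here; there)
open import Function using (_∘_)
open import Relation.Binary.Construct.Closure.Symmetric using (SymClosure; fwd; bwd)
open import Relation.Binary.PropositionalEquality
open import Relation.Nullary using (¬_; yes; no; contradiction; _⊎-dec_)
open import Relation.Unary using (Pred; Decidable; _≐_; Empty)
open import Level using (0ℓ)

-- Coefficients

-- Multiplication by x on coefficient sequences. Working with functions on exponents instead of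
-- lists makes trailing zeros invisible.
shift : (ℕ → ℕ) → ℕ → ℕ
shift f zero    = 0
shift f (suc k) = f k

shift-cong : ∀ {f g : ℕ → ℕ} → f ≗ g → shift f ≗ shift g
shift-cong f≗g zero    = refl
shift-cong f≗g (suc k) = f≗g k

shift-+ : ∀ f g k → shift (λ j → f j + g j) k ≡ shift f k + shift g k
shift-+ f g zero    = refl
shift-+ f g (suc k) = refl

coeff-⊕ : ∀ p q k → coeff (p ⊕ q) k ≡ coeff p k + coeff q k
coeff-⊕ []      q       k       = refl
coeff-⊕ (a ∷ p) []      k       = sym (+-identityʳ _)
coeff-⊕ (a ∷ p) (b ∷ q) zero    = refl
coeff-⊕ (a ∷ p) (b ∷ q) (suc k) = coeff-⊕ p q k

coeff-· : ∀ a p k → coeff (a · p) k ≡ a * coeff p k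
coeff-· a []      k       = sym (*-zeroʳ a)
coeff-· a (b ∷ p) zero    = refl
coeff-· a (b ∷ p) (suc k) = coeff-· a p k

coeff-∷⊗ : ∀ a p q k → coeff ((a ∷ p) ⊗ q) k ≡ a * coeff q k + shift (coeff (p ⊗ q)) k
coeff-∷⊗ a p q k = trans (coeff-⊕ (a · q) (0 ∷ (p ⊗ q)) k) (cong₂ _+_ (coeff-· a q k) (coeff-0∷ k))
  where
  coeff-0∷ : ∀ k → coeff (0 ∷ (p ⊗ q)) k ≡ shift (coeff (p ⊗ q)) k
  coeff-0∷ zero    = refl
  coeff-0∷ (suc k) = refl

coeff-x^-≡ : ∀ i → coeff (x^ i) i ≡ 1
coeff-x^-≡ zero    = refl
coeff-x^-≡ (suc i) = coeff-x^-≡ i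

coeff-x^-≢ : ∀ i k → i ≢ k → coeff (x^ i) k ≡ 0
coeff-x^-≢ zero    zero    i≢k = contradiction refl i≢k
coeff-x^-≢ zero    (suc k) i≢k = refl
coeff-x^-≢ (suc i) zero    i≢k = refl
coeff-x^-≢ (suc i) (suc k) i≢k = coeff-x^-≢ i k (i≢k ∘ cong suc)

coeff-sum-zero : ∀ (f : ℕ → Poly) l k → (∀ j → j < l → coeff (f j) k ≡ 0) →
  coeff (foldr _⊕_ [] (applyUpTo f l)) k ≡ 0
coeff-sum-zero f zero    k f≡0 = refl
coeff-sum-zero f (suc l) k f≡0 =
  trans (coeff-⊕ (f 0) _ k)
        (cong₂ _+_ (f≡0 0 (s≤s z≤n)) (coeff-sum-zero (f ∘ suc) l k λ j j<l → f≡0 (suc j) (s≤s j<l)))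

coeff-sum-single : ∀ (f : ℕ → Poly) l k j → j < l → (∀ i → i ≢ j → coeff (f i) k ≡ 0) →
  coeff (foldr _⊕_ [] (applyUpTo f l)) k ≡ coeff (f j) k
coeff-sum-single f (suc l) k zero    _         f≡0 =
  trans (coeff-⊕ (f 0) _ k)
        (trans (cong (coeff (f 0) k +_) (coeff-sum-zero (f ∘ suc) l k λ j _ → f≡0 (suc j) λ ()))
               (+-identityʳ _))
coeff-sum-single f (suc l) k (suc j) (s≤s j<l) f≡0 =
  trans (coeff-⊕ (f 0) _ k)
        (cong₂ _+_ (f≡0 0 λ ()) (coeff-sum-single (f ∘ suc) l k j j<l λ i i≢j → f≡0 (suc i) (i≢j ∘ suc-injective)))

module _ (e : ℕ → ℕ) where

  coeff-monomial-≢ : ∀ {i k} → i ≢ k → coeff (e i · x^ i) k ≡ 0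
  coeff-monomial-≢ {i} {k} i≢k = begin
    coeff (e i · x^ i) k  ≡⟨ coeff-· (e i) (x^ i) k ⟩
    e i * coeff (x^ i) k  ≡⟨ cong (e i *_) (coeff-x^-≢ i k i≢k) ⟩
    e i * 0               ≡⟨ *-zeroʳ (e i) ⟩
    0                     ∎
    where open ≡-Reasoning

  coeff-∑-inside : ∀ a b k → a ≤ k → k ≤ b → coeff (∑[ a to b ] λ i → e i · x^ i) k ≡ e k
  coeff-∑-inside a b k a≤k k≤b = begin
    -- The summation index is the offset from `a`, so the only term of degree `k` stands at `k ∸ a`.
    coeff (∑[ a to b ] monomial) k    ≡⟨ coeff-sum-single (λ j → monomial (a + j)) (suc b ∸ a) k (k ∸ a)
                                            (∸-monoˡ-< (s≤s k≤b) a≤k)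
                                            (λ i i≢ → coeff-monomial-≢ λ a+i≡k →
                                              i≢ (trans (sym (m+n∸m≡n a i)) (cong (_∸ a) a+i≡k))) ⟩
    coeff (monomial (a + (k ∸ a))) k  ≡⟨ cong (λ i → coeff (monomial i) k) (m+[n∸m]≡n a≤k) ⟩
    coeff (e k · x^ k) k              ≡⟨ coeff-· (e k) (x^ k) k ⟩
    e k * coeff (x^ k) k              ≡⟨ cong (e k *_) (coeff-x^-≡ k) ⟩
    e k * 1                           ≡⟨ *-identityʳ (e k) ⟩
    e k                               ∎
    where
    open ≡-Reasoning
    monomial : ℕ → Poly
    monomial i = e i · x^ i

  -- Outside the range every exponent `a + j` differs from `k`, so the sum contributes 0 there; the
  -- two vanishing hypotheses make `e` agree with it.
  coeff-∑ : ∀ a b → (∀ k → k < a → e k ≡ 0) → (∀ k → b < k → e k ≡ 0) →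
    ∀ k → coeff (∑[ a to b ] λ i → e i · x^ i) k ≡ e k
  coeff-∑ a b below above k with a ≤? k | k ≤? b
  ... | yes a≤k | yes k≤b = coeff-∑-inside a b k a≤k k≤b
  ... | no  a≰k | _       =
    trans (coeff-sum-zero _ (suc b ∸ a) k λ j _ → coeff-monomial-≢ λ a+j≡k → a≰k (subst (a ≤_) a+j≡k (m≤m+n a j)))
          (sym (below k (≰⇒> a≰k)))
  ... | yes a≤k | no  k≰b =
    trans (coeff-sum-zero _ (suc b ∸ a) k λ j j<l → coeff-monomial-≢ λ a+j≡k →
             k≰b (subst (_≤ b) a+j≡k (≤-pred (a+j<1+b j j<l))))
          (sym (above k (≰⇒> k≰b)))
    where
    a+j<1+b : ∀ j → j < suc b ∸ a → a + j < suc b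
    a+j<1+b j j<l = subst (_≤ suc b) (+-suc a j) (subst (a + suc j ≤_) (m+[n∸m]≡n a≤1+b) (+-monoʳ-≤ a j<l))
      where
      a≤1+b : a ≤ suc b
      -- Subtraction is truncated: some `j` lies below `suc b ∸ a`, so this difference is nonzero,
      -- which forces `a < suc b`.
      a≤1+b = <⇒≤ (m∸n≢0⇒n<m (>⇒≢ (≤-<-trans z≤n j<l)))

-- Counting subsets by cardinality

filter-map : ∀ {A B : Set} {P : Pred B 0ℓ} (P? : Decidable P) (f : A → B) (xs : List A) →
  filter P? (map f xs) ≡ map f (filter (P? ∘ f) xs)
filter-map P? f []       = refl
filter-map P? f (x ∷ xs) with P? (f x)
... | yes _ = cong (f x ∷_) (filter-map P? f xs)
... | no  _ = filter-map P? f xs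

module _ {n : ℕ} {P : Pred (Subset n) 0ℓ} where

  count : Decidable P → ℕ → ℕ
  count P? k = length (filter (λ S → ∣ S ∣ ≟ k) (filter P? (subsets n)))

  count-empty : (P? : Decidable P) → Empty P → ∀ k → count P? k ≡ 0
  count-empty P? ∅ k = cong (length ∘ filter (λ S → ∣ S ∣ ≟ k)) (filter-none P? (All.universal ∅ (subsets n)))

count-≐ : ∀ {n} {P Q : Pred (Subset n) 0ℓ} (P? : Decidable P) (Q? : Decidable Q) →
  P ≐ Q → count P? ≗ count Q?
count-≐ {n} P? Q? P≐Q k = cong (length ∘ filter (λ S → ∣ S ∣ ≟ k)) (filter-≐ P? Q? P≐Q (subsets n))

module _ {n : ℕ} {P : Pred (Subset (suc n)) 0ℓ} (P? : Decidable P) where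

  private
    size? : ∀ {m} k → Decidable (λ (S : Subset m) → ∣ S ∣ ≡ k)
    size? k S = ∣ S ∣ ≟ k

    half : ∀ s k → length (filter (size? k) (filter P? (map (s ∷_) (subsets n)))) ≡
      length (filter (size? k ∘ (s ∷_)) (filter (P? ∘ (s ∷_)) (subsets n)))
    half s k = begin
      length (filter (size? k) (filter P? (map (s ∷_) (subsets n))))
        ≡⟨ cong (length ∘ filter (size? k)) (filter-map P? (s ∷_) (subsets n)) ⟩
      length (filter (size? k) (map (s ∷_) Ss))
        ≡⟨ cong length (filter-map (size? k) (s ∷_) Ss) ⟩
      length (map (s ∷_) (filter (size? k ∘ (s ∷_)) Ss))
        ≡⟨ length-map (s ∷_) (filter (size? k ∘ (s ∷_)) Ss) ⟩
      length (filter (size? k ∘ (s ∷_)) Ss) ∎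
      where
      open ≡-Reasoning
      Ss : List (Subset n)
      Ss = filter (P? ∘ (s ∷_)) (subsets n)

    inside-sized : ∀ (Ss : List (Subset n)) k →
      length (filter (λ S → suc ∣ S ∣ ≟ k) Ss) ≡ shift (λ j → length (filter (size? j) Ss)) k
    inside-sized Ss zero    = cong length (filter-none (λ S → suc ∣ S ∣ ≟ 0) (All.universal (λ _ ()) Ss))
    inside-sized Ss (suc k) = cong length
      (filter-≐ (λ S → suc ∣ S ∣ ≟ suc k) (size? k) (suc-injective , cong suc) Ss)

  -- `subsets` lists the sets without the first element before those with it. Each set of the second
  -- half has one element more than its tail, hence the factor x.
  count-∷ : ∀ k → count P? k ≡ count (P? ∘ (outside ∷_)) k + shift (count (P? ∘ (inside ∷_))) k
  count-∷ k = begin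
    length (filter (size? k) (filter P? (outs ++ ins)))
      ≡⟨ cong (length ∘ filter (size? k)) (filter-++ P? outs ins) ⟩
    length (filter (size? k) (filter P? outs ++ filter P? ins))
      ≡⟨ cong length (filter-++ (size? k) (filter P? outs) (filter P? ins)) ⟩
    length (filter (size? k) (filter P? outs) ++ filter (size? k) (filter P? ins))
      ≡⟨ length-++ (filter (size? k) (filter P? outs)) ⟩
    length (filter (size? k) (filter P? outs)) + length (filter (size? k) (filter P? ins))
      ≡⟨ cong₂ _+_ (half outside k) (trans (half inside k) (inside-sized (filter (P? ∘ (inside ∷_)) (subsets n)) k)) ⟩
    count (P? ∘ (outside ∷_)) k + shift (count (P? ∘ (inside ∷_))) k ∎
    where
    open ≡-Reasoning
    outs ins : List (Subset (suc n))
    outs = map (outside ∷_) (subsets n)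
    ins  = map (inside ∷_) (subsets n)

-- The bounds of the sum cut off nothing: no dominating set is smaller than the minimum `γ G`, and
-- no subset is larger than `order`.
coeff-D : ∀ G k → coeff (D G) k ≡ d G k
coeff-D G = coeff-∑ (d G) (γ G) order
  (λ k k<γ → d≡0 k (All.map (λ γ≤∣S∣ ∣S∣≡k → <⇒≱ k<γ (subst (γ G ≤_) ∣S∣≡k γ≤∣S∣))
                            (map⁻ (min≤xs order (map ∣_∣ (dominatingSets G))))))
  (λ k o<k → d≡0 k (All.universal (λ S ∣S∣≡k → <⇒≱ o<k (subst (_≤ order) ∣S∣≡k (∣p∣≤n S)))
                                  (dominatingSets G)))
  where
  open Graph G
  d≡0 : ∀ k → All (λ S → ∣ S ∣ ≢ k) (dominatingSets G) → d G k ≡ 0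
  d≡0 k none = cong length (filter-none (λ S → ∣ S ∣ ≟ k) none)

-- Transversals of the triangles

Meets : ∀ n → Subset (suc (n * 2)) → Fin n → Set
Meets n S i = c n (inject₁ i) ∈ S ⊎ m n i ∈ S ⊎ c n (suc i) ∈ S

Transversal : ∀ n → Pred (Subset (suc (n * 2))) 0ℓ
Transversal n S = ∀ i → Meets n S i

transversal? : ∀ n → Decidable (Transversal n)
transversal? n S = all? λ i → (c n (inject₁ i) ∈? S) ⊎-dec ((m n i ∈? S) ⊎-dec (c n (suc i) ∈? S))

-- The endpoints are variables tied by equations because `c` and `m` are functions: matching on an
-- edge with the fixed endpoint `m n i` would leave unification stuck.
m-edge : ∀ {n u v} → Edge n u v → ∀ {i} →
  (u ≡ m n i → v ≡ c n (inject₁ i) ⊎ v ≡ c n (suc i)) ×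
  (v ≡ m n i → u ≡ c n (inject₁ i) ⊎ u ≡ c n (suc i))
m-edge {n} (cc j) {i} = (λ p → ⊥-elim (c≢m n _ i p)) , (λ p → ⊥-elim (c≢m n _ i p))
m-edge {n} (cm j) {i} = (λ p → ⊥-elim (c≢m n _ i p)) , (λ p → inj₁ (cong (c n ∘ inject₁) (m-injective n p)))
m-edge {n} (mc j) {i} = (λ p → inj₂ (cong (c n ∘ suc) (m-injective n p))) , (λ p → ⊥-elim (c≢m n _ i p))

m-neighbour : ∀ {n i u} → SymClosure (Edge n) (m n i) u → u ≡ c n (inject₁ i) ⊎ u ≡ c n (suc i)
m-neighbour (fwd e) = proj₁ (m-edge e) refl
m-neighbour (bwd e) = proj₂ (m-edge e) refl

dominating⇒transversal : ∀ n {S} → Dominating (T n) S → Transversal n S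
dominating⇒transversal n {S} dom i with m n i ∈? S
... | yes m∈S = inj₂ (inj₁ m∈S)
... | no  m∉S with dom (m n i) m∉S
...   | u , u∈S , m~u with m-neighbour m~u
...     | inj₁ refl = inj₁ u∈S
...     | inj₂ refl = inj₂ (inj₂ u∈S)

-- Each vertex needs just one triangle through it: mᵢ has its own, c₀ takes the first, and any other
-- cᵢ takes the triangle that ends in it. Length at least 1 matters for c₀: in `T 0` the empty set
-- is a transversal but does not dominate.
transversal⇒dominating : ∀ n {S} → Transversal (suc n) S → Dominating (T (suc n)) S
transversal⇒dominating n {S} meets v v∉S with c-or-m (suc n) v
... | inj₂ (i , refl) with meets i
...   | inj₁ c∈S        = _ , c∈S , bwd (cm i)
...   | inj₂ (inj₁ m∈S) = contradiction m∈S v∉S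
...   | inj₂ (inj₂ c∈S) = _ , c∈S , fwd (mc i)
transversal⇒dominating n {S} meets v v∉S | inj₁ (zero , refl) with meets zero
...   | inj₁ c∈S        = contradiction c∈S v∉S
...   | inj₂ (inj₁ m∈S) = _ , m∈S , fwd (cm zero)
...   | inj₂ (inj₂ c∈S) = _ , c∈S , fwd (cc zero)
transversal⇒dominating n {S} meets v v∉S | inj₁ (suc i , refl) with meets i
...   | inj₁ c∈S        = _ , c∈S , bwd (cc i)
...   | inj₂ (inj₁ m∈S) = _ , m∈S , bwd (mc i)
...   | inj₂ (inj₂ c∈S) = contradiction c∈S v∉S

-- Deleting c₀ and m₁ leaves the chain of length `n` that starts at c₁. At successor indices `c` and
-- `m` reduce to `suc (suc _)`, so membership moves by two positions.
transversal-tail : ∀ n {s t S} → Transversal (suc n) (s ∷ t ∷ S) → Transversal n S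
transversal-tail n meets i = Sum.map drop₂ (Sum.map drop₂ drop₂) (meets (suc i))
  where
  drop₂ : ∀ {s t S j} → suc (suc j) ∈ s ∷ t ∷ S → j ∈ S
  drop₂ = drop-there ∘ drop-there

transversal-∷ : ∀ n {s t S} → Meets (suc n) (s ∷ t ∷ S) zero → Transversal n S → Transversal (suc n) (s ∷ t ∷ S)
transversal-∷ n meets₀ meets zero    = meets₀
transversal-∷ n meets₀ meets (suc i) = Sum.map there₂ (Sum.map there₂ there₂) (meets i)
  where
  there₂ : ∀ {s t S j} → j ∈ S → suc (suc j) ∈ s ∷ t ∷ S
  there₂ = there ∘ there

-- Recurrences for the transversal counts

N A B : ℕ → ℕ → ℕ
N n = count (transversal? n)
A n = count (transversal? n ∘ (inside ∷_))
B n = count (transversal? n ∘ (outside ∷_))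

-- `A` measures a set without its element c₀; the shift restores that element.
N-split : ∀ n k → N n k ≡ B n k + shift (A n) k
N-split n = count-∷ (transversal? n)

-- Once c₀ is chosen, the first triangle is met: m₁ is free and the rest is any transversal of the
-- shorter chain.
A-suc : ∀ n k → A (suc n) k ≡ N n k + shift (N n) k
A-suc n k = trans (count-∷ (transversal? (suc n) ∘ (inside ∷_)) k)
                  (cong₂ _+_ (free outside k) (shift-cong (free inside) k))
  where
  free : ∀ t → count (λ S → transversal? (suc n) (inside ∷ t ∷ S)) ≗ N n
  free t = count-≐ (λ S → transversal? (suc n) (inside ∷ t ∷ S)) (transversal? n)
    (transversal-tail n , transversal-∷ n (inj₁ here))

-- Without c₀, either m₁ is chosen and the rest is any transversal of the shorter chain, or m₁ is
-- left out and c₁ is forced, which makes the rest a transversal containing its first vertex.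
B-suc : ∀ n k → B (suc n) k ≡ shift (A n) k + shift (N n) k
B-suc n k = trans (count-∷ (transversal? (suc n) ∘ (outside ∷_)) k)
                  (cong₂ _+_ m₁∉S (shift-cong m₁∈S k))
  where
  m₁∈S : count (λ S → transversal? (suc n) (outside ∷ inside ∷ S)) ≗ N n
  m₁∈S = count-≐ (λ S → transversal? (suc n) (outside ∷ inside ∷ S)) (transversal? n)
    (transversal-tail n , transversal-∷ n (inj₂ (inj₁ (there here))))

  misses : ∀ {S} → ¬ Transversal (suc n) (outside ∷ outside ∷ outside ∷ S)
  misses meets with meets zero
  ... | inj₁ ()
  ... | inj₂ (inj₁ (there ()))
  ... | inj₂ (inj₂ (there (there ())))

  c₁∈S : count (λ S → transversal? (suc n) (outside ∷ outside ∷ inside ∷ S)) ≗ A n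
  c₁∈S = count-≐ (λ S → transversal? (suc n) (outside ∷ outside ∷ inside ∷ S)) (transversal? n ∘ (inside ∷_))
    (transversal-tail n , transversal-∷ n (inj₂ (inj₂ (there (there here)))))

  m₁∉S : count (λ S → transversal? (suc n) (outside ∷ outside ∷ S)) k ≡ shift (A n) k
  m₁∉S = trans (count-∷ (λ S → transversal? (suc n) (outside ∷ outside ∷ S)) k)
    (cong₂ _+_ (count-empty (λ S → transversal? (suc n) (outside ∷ outside ∷ outside ∷ S)) (λ _ → misses) k)
               (shift-cong c₁∈S k))

shift-A-suc : ∀ n k → shift (A (suc n)) k ≡ shift (N n) k + shift (shift (N n)) k
shift-A-suc n k = trans (shift-cong (A-suc n) k) (shift-+ (N n) (shift (N n)) k)

N-recurrence : ∀ n k → N (2 + n) k ≡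
  (2 * shift (N (suc n)) k + shift (shift (N (suc n))) k) + (shift (N n) k + shift (shift (N n)) k)
N-recurrence n k = begin
  N (2 + n) k
    ≡⟨ N-split (2 + n) k ⟩
  B (2 + n) k + shift (A (2 + n)) k
    ≡⟨ cong₂ _+_ (B-suc (suc n) k) (shift-A-suc (suc n) k) ⟩
  (shift (A (suc n)) k + xN) + (xN + x²N)
    -- The last occurrence of `A` is eliminated; this is where the count for length `n` enters.
    ≡⟨ cong (λ z → (z + xN) + (xN + x²N)) (shift-A-suc n k) ⟩
  ((shift (N n) k + shift (shift (N n)) k) + xN) + (xN + x²N)
    ≡⟨ rearrange (shift (N n) k + shift (shift (N n)) k) xN x²N ⟩
  (2 * xN + x²N) + (shift (N n) k + shift (shift (N n)) k) ∎
  where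
  open ≡-Reasoning
  xN x²N : ℕ
  xN  = shift (N (suc n)) k
  x²N = shift (shift (N (suc n))) k

  rearrange : ∀ a b c → (a + b) + (b + c) ≡ (2 * b + c) + a
  rearrange = solve-∀

-- From transversal counts to domination polynomials

coeff-D-T : ∀ n k → coeff (D (T (suc n))) k ≡ N (suc n) k
coeff-D-T n k = trans (coeff-D (T (suc n)) k)
  -- `d` unfolds to `count` of `dominating?`, so equivalence of the two predicates suffices.
  (count-≐ (dominating? (T (suc n))) (transversal? (suc n))
           (dominating⇒transversal (suc n) , transversal⇒dominating n) k)

-- Both quadratic factors of the theorem evaluate to this shape: x² + 2x to `0 ∷ 2 ∷ 1 ∷ []` and x²
-- + x to `0 ∷ 1 ∷ 1 ∷ []`.
coeff-quadratic⊗ : ∀ b a q k →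
  coeff ((0 ∷ b ∷ a ∷ []) ⊗ q) k ≡ b * shift (coeff q) k + a * shift (shift (coeff q)) k
coeff-quadratic⊗ b a q k = trans (coeff-∷⊗ 0 (b ∷ a ∷ []) q k) (lemma k)
  where
  linear : ∀ k → coeff ((a ∷ []) ⊗ q) k ≡ a * coeff q k
  linear k = trans (coeff-∷⊗ a [] q k) (trans (cong (a * coeff q k +_) (shift-zero k)) (+-identityʳ _))
    where
    shift-zero : ∀ k → shift (coeff []) k ≡ 0
    shift-zero zero    = refl
    shift-zero (suc k) = refl

  lemma : ∀ k → shift (coeff ((b ∷ a ∷ []) ⊗ q)) k ≡ b * shift (coeff q) k + a * shift (shift (coeff q)) k
  lemma zero          = sym (cong₂ _+_ (*-zeroʳ b) (*-zeroʳ a))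
  lemma (suc zero)    = trans (coeff-∷⊗ b (a ∷ []) q 0) (cong (b * coeff q 0 +_) (sym (*-zeroʳ a)))
  lemma (suc (suc k)) = trans (coeff-∷⊗ b (a ∷ []) q (suc k)) (cong (b * coeff q (suc k) +_) (linear k))

theorem4 : (∀ (n : ℕ) → n ≥ 3 →
    D (T n) ≈ (x^ 2 ⊕ 2 · x^ 1) ⊗ D (T (n ∸ 1)) ⊕ (x^ 2 ⊕ x^ 1) ⊗ D (T (n ∸ 2)))
    × D (T 1) ≈ x^ 3 ⊕ 3 · x^ 2 ⊕ 3 · x^ 1
    × D (T 2) ≈ x^ 5 ⊕ 5 · x^ 4 ⊕ 10 · x^ 3 ⊕ 8 · x^ 2 ⊕ x^ 1
-- In the initial conditions both sides are closed terms that evaluate to the same coefficient list,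
-- so `refl` holds with the exponent still a variable.
theorem4 = recurrence , (λ _ → refl) , (λ _ → refl)
  where
  recurrence : ∀ n → n ≥ 3 →
    D (T n) ≈ (x^ 2 ⊕ 2 · x^ 1) ⊗ D (T (n ∸ 1)) ⊕ (x^ 2 ⊕ x^ 1) ⊗ D (T (n ∸ 2))
  recurrence (suc (suc (suc n))) (s≤s (s≤s (s≤s _))) k = begin
    coeff (D (T (3 + n))) k
      ≡⟨ coeff-D-T (2 + n) k ⟩
    N (3 + n) k
      -- With index `suc n` all three lengths are at least 1, the range in which `N` gives the
      -- coefficients of `D`.
      ≡⟨ N-recurrence (suc n) k ⟩
    (2 * shift (N (2 + n)) k + shift (shift (N (2 + n))) k) + (shift (N (1 + n)) k + shift (shift (N (1 + n))) k)
      -- Factors 1 are inserted to fit the form of `coeff-quadratic⊗`.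
      ≡⟨ cong₂ _+_
           (cong₂ (λ y z → 2 * y + z) (shift-cong N≗D₂ k) (trans (shift-cong (shift-cong N≗D₂) k) (sym (*-identityˡ _))))
           (cong₂ _+_ (trans (shift-cong N≗D₁ k) (sym (*-identityˡ _)))
                      (trans (shift-cong (shift-cong N≗D₁) k) (sym (*-identityˡ _)))) ⟩
    (2 * shift (coeff D₂) k + 1 * shift (shift (coeff D₂)) k) + (1 * shift (coeff D₁) k + 1 * shift (shift (coeff D₁)) k)
      ≡⟨ cong₂ _+_ (coeff-quadratic⊗ 2 1 D₂ k) (coeff-quadratic⊗ 1 1 D₁ k) ⟨
    coeff ((x^ 2 ⊕ 2 · x^ 1) ⊗ D₂) k + coeff ((x^ 2 ⊕ x^ 1) ⊗ D₁) k
      ≡⟨ coeff-⊕ ((x^ 2 ⊕ 2 · x^ 1) ⊗ D₂) ((x^ 2 ⊕ x^ 1) ⊗ D₁) k ⟨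
    coeff ((x^ 2 ⊕ 2 · x^ 1) ⊗ D₂ ⊕ (x^ 2 ⊕ x^ 1) ⊗ D₁) k ∎
    where
    open ≡-Reasoning
    D₁ D₂ : Poly
    D₁ = D (T (1 + n))
    D₂ = D (T (2 + n))

    N≗D₁ : N (1 + n) ≗ coeff D₁
    N≗D₁ = sym ∘ coeff-D-T n

    N≗D₂ : N (2 + n) ≗ coeff D₂
    N≗D₂ = sym ∘ coeff-D-T (1 + n)
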